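{- Let $k\ge0$. The theory $\mathsf{HA}+\mathrm{LEM}(\Sigma_k)$ is closed under the independence-of-premise rule: for all formulas $\varphi,\psi$ of the language of $\mathsf{HA}$ and every variable $x$ not free in $\neg\varphi$, if $\mathsf{HA}+\mathrm{LEM}(\Sigma_k)\vdash\neg\varphi\to\exists x\psi$, then $\mathsf{HA}+\mathrm{LEM}(\Sigma_k)\vdash\exists x(\neg\varphi\to\psi)$.
   Context: $\mathsf{HA}$ is intuitionistic first-order arithmetic with function symbols for all primitive recursive functions and logical constants $\forall,\exists,\to,\land,\lor,\perp$ ($\neg\varphi:\equiv\varphi\to\perp$). $\Sigma_0=\Pi_0$ = quantifier-free formulas; $\Sigma_{m+1}$ = formulas $\exists x_1\cdots\exists x_n\varphi$, $\varphi\in\Pi_m$; $\Pi_{m+1}$ = formulas $\forall x_1\cdots\forall x_n\varphi$, $\varphi\in\Sigma_m$. $\mathrm{LEM}(\Sigma_k)$ is the scheme $\varphi\lor\neg\varphi$ for $\varphi\in\Sigma_k$ (free variables allowed). -}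

module Defs where

open import Data.Nat using (ℕ; zero; suc)
open import Data.Fin using (Fin)
open import Data.Vec using (Vec; []; _∷_; lookup; map)

-- Codes for primitive recursive functions (one function symbol each)

data PR : ℕ → Set where
  Z : PR 0
  S : PR 1
  P : ∀ {n} → Fin n → PR n
  C : ∀ {m n} → PR m → Vec (PR n) m → PR n
  R : ∀ {n} → PR n → PR (suc (suc n)) → PR (suc n)
  -- R f g (0 , xs) = f xs ;  R f g (y+1 , xs) = g (R f g (y , xs) , y , xs)

data Term : Set where
  var : ℕ → Term
  app : ∀ {n} → PR n → Vec Term n → Term

zeroT : Term
zeroT = app Z []

sucT : Term → Term
sucT t = app S (t ∷ [])

infix  7 _≐_
infixr 6 _∧'_
infixr 5 _∨'_
infixr 4 _⇒_

data Formula : Set where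
  _≐_  : Term → Term → Formula
  ⊥'   : Formula
  _∧'_ : Formula → Formula → Formula
  _∨'_ : Formula → Formula → Formula
  _⇒_  : Formula → Formula → Formula
  ∀'   : Formula → Formula     -- binds de Bruijn variable 0
  ∃'   : Formula → Formula     -- binds de Bruijn variable 0

¬' : Formula → Formula
¬' φ = φ ⇒ ⊥'

Subst : Set
Subst = ℕ → Term

mutual
  substT : Subst → Term → Term
  substT σ (var i)    = σ i
  substT σ (app f ts) = app f (substTs σ ts)

  substTs : ∀ {n} → Subst → Vec Term n → Vec Term n
  substTs σ []       = []
  substTs σ (t ∷ ts) = substT σ t ∷ substTs σ ts

wkT : Term → Term
wkT = substT (λ i → var (suc i))

lift : Subst → Subst
lift σ zero    = var zero
lift σ (suc i) = wkT (σ i)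

substF : Subst → Formula → Formula
substF σ (t ≐ s)  = substT σ t ≐ substT σ s
substF σ ⊥'       = ⊥'
substF σ (φ ∧' ψ) = substF σ φ ∧' substF σ ψ
substF σ (φ ∨' ψ) = substF σ φ ∨' substF σ ψ
substF σ (φ ⇒ ψ)  = substF σ φ ⇒ substF σ ψ
substF σ (∀' φ)   = ∀' (substF (lift σ) φ)
substF σ (∃' φ)   = ∃' (substF (lift σ) φ)

-- weakening: shift every free variable up by one (so variable 0 is not free)
wk : Formula → Formula
wk = substF (λ i → var (suc i))

sub0 : Term → Subst
sub0 t zero    = t
sub0 t (suc i) = var i

_[_] : Formula → Term → Formula
φ [ t ] = substF (sub0 t) φ

subSuc : Subst
subSuc zero    = sucT (var zero)
subSuc (suc i) = var (suc i)

data QF : Formula → Set where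
  qf≐ : ∀ {t s} → QF (t ≐ s)
  qf⊥ : QF ⊥'
  qf∧ : ∀ {φ ψ} → QF φ → QF ψ → QF (φ ∧' ψ)
  qf∨ : ∀ {φ ψ} → QF φ → QF ψ → QF (φ ∨' ψ)
  qf⇒ : ∀ {φ ψ} → QF φ → QF ψ → QF (φ ⇒ ψ)

exs : ℕ → Formula → Formula
exs zero    φ = φ
exs (suc n) φ = ∃' (exs n φ)

alls : ℕ → Formula → Formula
alls zero    φ = φ
alls (suc n) φ = ∀' (alls n φ)

mutual
  data Σ-form : ℕ → Formula → Set where
    σ0 : ∀ {φ} → QF φ → Σ-form 0 φ
    σS : ∀ {m φ} (n : ℕ) → Π-form m φ → Σ-form (suc m) (exs n φ)

  data Π-form : ℕ → Formula → Set where
    π0 : ∀ {φ} → QF φ → Π-form 0 φ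
    πS : ∀ {m φ} (n : ℕ) → Σ-form m φ → Π-form (suc m) (alls n φ)

data HA-Ax : Formula → Set where
  eq-refl  : ∀ t → HA-Ax (t ≐ t)
  eq-subst : ∀ t s φ → HA-Ax (t ≐ s ⇒ φ [ t ] ⇒ φ [ s ])
  suc-ne0  : ∀ t → HA-Ax (¬' (sucT t ≐ zeroT))
  suc-inj  : ∀ t s → HA-Ax (sucT t ≐ sucT s ⇒ t ≐ s)
  ax-P     : ∀ {n} (i : Fin n) (ts : Vec Term n) → HA-Ax (app (P i) ts ≐ lookup ts i)
  ax-C     : ∀ {m n} (f : PR m) (gs : Vec (PR n) m) (ts : Vec Term n) →
             HA-Ax (app (C f gs) ts ≐ app f (map (λ g → app g ts) gs))
  ax-R0    : ∀ {n} (f : PR n) (g : PR (suc (suc n))) (ts : Vec Term n) →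
             HA-Ax (app (R f g) (zeroT ∷ ts) ≐ app f ts)
  ax-RS    : ∀ {n} (f : PR n) (g : PR (suc (suc n))) (t : Term) (ts : Vec Term n) →
             HA-Ax (app (R f g) (sucT t ∷ ts) ≐ app g (app (R f g) (t ∷ ts) ∷ t ∷ ts))
  ind      : ∀ φ → HA-Ax (φ [ zeroT ] ⇒ ∀' (φ ⇒ substF subSuc φ) ⇒ ∀' φ)

data Ax (k : ℕ) : Formula → Set where
  ha  : ∀ {φ} → HA-Ax φ → Ax k φ
  lem : ∀ {φ} → Σ-form k φ → Ax k (φ ∨' ¬' φ)

-- Hilbert-style intuitionistic first-order logic over a set of axioms
-- (free variables allowed in theorems)

data _⊢_ (T : Formula → Set) : Formula → Set where
  axiom : ∀ {φ} → T φ → T ⊢ φ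
  K     : ∀ {φ ψ} → T ⊢ (φ ⇒ ψ ⇒ φ)
  Sc    : ∀ {φ ψ χ} → T ⊢ ((φ ⇒ ψ ⇒ χ) ⇒ (φ ⇒ ψ) ⇒ φ ⇒ χ)
  ∧E₁   : ∀ {φ ψ} → T ⊢ (φ ∧' ψ ⇒ φ)
  ∧E₂   : ∀ {φ ψ} → T ⊢ (φ ∧' ψ ⇒ ψ)
  ∧I    : ∀ {φ ψ} → T ⊢ (φ ⇒ ψ ⇒ φ ∧' ψ)
  ∨I₁   : ∀ {φ ψ} → T ⊢ (φ ⇒ φ ∨' ψ)
  ∨I₂   : ∀ {φ ψ} → T ⊢ (ψ ⇒ φ ∨' ψ)
  ∨E    : ∀ {φ ψ χ} → T ⊢ ((φ ⇒ χ) ⇒ (ψ ⇒ χ) ⇒ φ ∨' ψ ⇒ χ)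
  efq   : ∀ {φ} → T ⊢ (⊥' ⇒ φ)
  ∀E    : ∀ {φ} t → T ⊢ (∀' φ ⇒ φ [ t ])
  ∃I    : ∀ {φ} t → T ⊢ (φ [ t ] ⇒ ∃' φ)
  mp    : ∀ {φ ψ} → T ⊢ (φ ⇒ ψ) → T ⊢ φ → T ⊢ ψ
  ∀I    : ∀ {φ ψ} → T ⊢ (wk ψ ⇒ φ) → T ⊢ (ψ ⇒ ∀' φ)
  ∃E    : ∀ {φ ψ} → T ⊢ (φ ⇒ wk ψ) → T ⊢ (∃' φ ⇒ ψ)

HA+LEM : ℕ → Formula → Set
HA+LEM k φ = Ax k ⊢ φ

{-# OPTIONS --safe #-}

-- Fix χ = ¬φ and translate A to A* by combining the Friedman translation with
-- the Aczel slash, "χ ⊢" being internalised as "χ ⇒": atoms P become P ∨ ¬χ,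
-- ⊥ becomes ¬χ, A ⇒ B becomes (A* ⇒ B*) ∧ (χ ⇒ A ⇒ B), and the other
-- connectives are left alone.  Then A* ⇒ (χ ⇒ A) and ¬χ ⇒ A* are provable, and
-- the translation of a theorem is a theorem.  For LEM(Σ_k): a prenex A implies
-- A*, and ¬A implies (¬A)* because A* ∧ χ gives A.
-- Finally (¬φ)* is provable, since φ* gives ¬φ ⇒ φ, hence ¬¬φ.  So a proof of
-- ¬φ ⇒ ∃x ψ yields one of ∃x ψ*, hence one of ∃x (¬φ ⇒ ψ).

module Submission where

open import Defs
open import Data.Nat using (ℕ; zero; suc)
open import Data.List using (List; []; _∷_)
import Data.List as List
open import Data.List.Membership.Propositional using (_∈_)
open import Data.List.Relation.Unary.Any using (here; there)
open import Data.Vec using (Vec; []; _∷_)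
open import Function using (_∘_)
open import Relation.Binary.PropositionalEquality using (_≡_; refl; sym; trans; cong; cong₂; subst; subst₂)

-- Substitution

mutual
  substT-cong : ∀ {σ τ} → (∀ i → σ i ≡ τ i) → ∀ t → substT σ t ≡ substT τ t
  substT-cong σ≗τ (var i)    = σ≗τ i
  substT-cong σ≗τ (app f ts) = cong (app f) (substTs-cong σ≗τ ts)

  substTs-cong : ∀ {σ τ} → (∀ i → σ i ≡ τ i) →
                 ∀ {n} (ts : Vec Term n) → substTs σ ts ≡ substTs τ ts
  substTs-cong σ≗τ []       = refl
  substTs-cong σ≗τ (t ∷ ts) = cong₂ _∷_ (substT-cong σ≗τ t) (substTs-cong σ≗τ ts)

mutual
  substT-∘ : ∀ τ σ t → substT τ (substT σ t) ≡ substT (substT τ ∘ σ) t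
  substT-∘ τ σ (var i)    = refl
  substT-∘ τ σ (app f ts) = cong (app f) (substTs-∘ τ σ ts)

  substTs-∘ : ∀ τ σ {n} (ts : Vec Term n) →
              substTs τ (substTs σ ts) ≡ substTs (substT τ ∘ σ) ts
  substTs-∘ τ σ []       = refl
  substTs-∘ τ σ (t ∷ ts) = cong₂ _∷_ (substT-∘ τ σ t) (substTs-∘ τ σ ts)

mutual
  substT-var : ∀ t → substT var t ≡ t
  substT-var (var i)    = refl
  substT-var (app f ts) = cong (app f) (substTs-var ts)

  substTs-var : ∀ {n} (ts : Vec Term n) → substTs var ts ≡ ts
  substTs-var []       = refl
  substTs-var (t ∷ ts) = cong₂ _∷_ (substT-var t) (substTs-var ts)

lift-cong : ∀ {σ τ} → (∀ i → σ i ≡ τ i) → ∀ i → lift σ i ≡ lift τ i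
lift-cong σ≗τ zero    = refl
lift-cong σ≗τ (suc i) = cong wkT (σ≗τ i)

lift-∘ : ∀ τ σ i → substT (lift τ) (lift σ i) ≡ lift (substT τ ∘ σ) i
lift-∘ τ σ zero    = refl
lift-∘ τ σ (suc i) = trans (substT-∘ (lift τ) (var ∘ suc) (σ i))
                           (sym (substT-∘ (var ∘ suc) τ (σ i)))

lift-var : ∀ i → lift var i ≡ var i
lift-var zero    = refl
lift-var (suc i) = refl

substF-cong : ∀ {σ τ} → (∀ i → σ i ≡ τ i) → ∀ A → substF σ A ≡ substF τ A
substF-cong σ≗τ (t ≐ s)  = cong₂ _≐_ (substT-cong σ≗τ t) (substT-cong σ≗τ s)
substF-cong σ≗τ ⊥'       = refl
substF-cong σ≗τ (A ∧' B) = cong₂ _∧'_ (substF-cong σ≗τ A) (substF-cong σ≗τ B)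
substF-cong σ≗τ (A ∨' B) = cong₂ _∨'_ (substF-cong σ≗τ A) (substF-cong σ≗τ B)
substF-cong σ≗τ (A ⇒ B)  = cong₂ _⇒_ (substF-cong σ≗τ A) (substF-cong σ≗τ B)
substF-cong σ≗τ (∀' A)   = cong ∀' (substF-cong (lift-cong σ≗τ) A)
substF-cong σ≗τ (∃' A)   = cong ∃' (substF-cong (lift-cong σ≗τ) A)

substF-∘ : ∀ τ σ A → substF τ (substF σ A) ≡ substF (substT τ ∘ σ) A
substF-∘ τ σ (t ≐ s)  = cong₂ _≐_ (substT-∘ τ σ t) (substT-∘ τ σ s)
substF-∘ τ σ ⊥'       = refl
substF-∘ τ σ (A ∧' B) = cong₂ _∧'_ (substF-∘ τ σ A) (substF-∘ τ σ B)
substF-∘ τ σ (A ∨' B) = cong₂ _∨'_ (substF-∘ τ σ A) (substF-∘ τ σ B)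
substF-∘ τ σ (A ⇒ B)  = cong₂ _⇒_ (substF-∘ τ σ A) (substF-∘ τ σ B)
substF-∘ τ σ (∀' A)   = cong ∀' (trans (substF-∘ (lift τ) (lift σ) A) (substF-cong (lift-∘ τ σ) A))
substF-∘ τ σ (∃' A)   = cong ∃' (trans (substF-∘ (lift τ) (lift σ) A) (substF-cong (lift-∘ τ σ) A))

substF-var : ∀ A → substF var A ≡ A
substF-var (t ≐ s)  = cong₂ _≐_ (substT-var t) (substT-var s)
substF-var ⊥'       = refl
substF-var (A ∧' B) = cong₂ _∧'_ (substF-var A) (substF-var B)
substF-var (A ∨' B) = cong₂ _∨'_ (substF-var A) (substF-var B)
substF-var (A ⇒ B)  = cong₂ _⇒_ (substF-var A) (substF-var B)
substF-var (∀' A)   = cong ∀' (trans (substF-cong lift-var A) (substF-var A))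
substF-var (∃' A)   = cong ∃' (trans (substF-cong lift-var A) (substF-var A))

substF-lift-wk : ∀ σ A → substF (lift σ) (wk A) ≡ wk (substF σ A)
substF-lift-wk σ A = trans (substF-∘ (lift σ) (var ∘ suc) A)
                           (sym (substF-∘ (var ∘ suc) σ A))

wk-[] : ∀ A t → wk A [ t ] ≡ A
wk-[] A t = trans (substF-∘ (sub0 t) (var ∘ suc) A) (substF-var A)

subSuc-wk : ∀ A → substF subSuc (wk A) ≡ wk A
subSuc-wk A = substF-∘ subSuc (var ∘ suc) A

-- Makes variable 0 usable as the eigenvariable: after weakening, instantiating a bound variable
-- with it returns the original body.
lift-wk-[var0] : ∀ A → substF (lift (var ∘ suc)) A [ var 0 ] ≡ A
lift-wk-[var0] A = trans (substF-∘ (sub0 (var 0)) (lift (var ∘ suc)) A)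
                         (trans (substF-cong (λ { zero → refl ; (suc i) → refl }) A) (substF-var A))

-- Natural deduction inside the Hilbert system

-- There is no constant for truth, so the empty conjunction is an instance of `efq`.
⋀ : List Formula → Formula
⋀ []      = ⊥' ⇒ ⊥'
⋀ (A ∷ Γ) = A ∧' ⋀ Γ

module Entailment (T : Formula → Set) where

  infix 2 _⊩_

  -- A record rather than an abbreviation, so that unification can recover `Γ`, which `⋀ Γ` would
  -- not determine.
  record _⊩_ (Γ : List Formula) (A : Formula) : Set where
    constructor entails
    field derivation : T ⊢ (⋀ Γ ⇒ A)

  open _⊩_ public

  private variable
    Γ Δ : List Formula
    A B D : Formula

  theorem : T ⊢ A → Γ ⊩ A
  theorem d = entails (mp K d)

  infixl 5 _·_
  _·_ : Γ ⊩ A ⇒ B → Γ ⊩ A → Γ ⊩ B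
  entails f · entails a = entails (mp (mp Sc f) a)

  hyp : A ∈ Γ → Γ ⊩ A
  hyp (here refl) = entails ∧E₁
  hyp (there A∈Γ) = entails (mp (mp Sc (mp K (derivation (hyp A∈Γ)))) ∧E₂)

  -- With contexts stored as conjunctions, the deduction theorem is mere currying and needs no
  -- induction on derivations.
  ƛ_ : A ∷ Γ ⊩ B → Γ ⊩ A ⇒ B
  ƛ entails d = entails (mp (mp Sc (mp K (mp Sc (mp K d)))) flip∧)
    where
    flip∧ : ∀ {A B} → T ⊢ (A ⇒ B ⇒ B ∧' A)
    flip∧ = mp (mp Sc (mp K (mp Sc ∧I))) K

  infixr 1 ƛ_

  closed : [] ⊩ A → T ⊢ A
  closed (entails d) = mp d efq

  weaken : (∀ {A} → A ∈ Γ → A ∈ Δ) → Γ ⊩ A → Δ ⊩ A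
  weaken {Γ} {Δ} Γ⊆Δ (entails d) = theorem d · conj Γ Γ⊆Δ
    where
    conj : ∀ Γ → (∀ {A} → A ∈ Γ → A ∈ Δ) → Δ ⊩ ⋀ Γ
    conj []      _   = theorem efq
    conj (A ∷ Γ) Γ⊆Δ = theorem ∧I · hyp (Γ⊆Δ (here refl)) · conj Γ (Γ⊆Δ ∘ there)

  unƛ : Γ ⊩ A ⇒ B → A ∷ Γ ⊩ B
  unƛ f = weaken there f · hyp (here refl)

  pair : Γ ⊩ A → Γ ⊩ B → Γ ⊩ A ∧' B
  pair a b = theorem ∧I · a · b

  fst : Γ ⊩ A ∧' B → Γ ⊩ A
  fst p = theorem ∧E₁ · p

  snd : Γ ⊩ A ∧' B → Γ ⊩ B
  snd p = theorem ∧E₂ · p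

  inl : Γ ⊩ A → Γ ⊩ A ∨' B
  inl a = theorem ∨I₁ · a

  inr : Γ ⊩ B → Γ ⊩ A ∨' B
  inr b = theorem ∨I₂ · b

  cases : Γ ⊩ A ∨' B → A ∷ Γ ⊩ D → B ∷ Γ ⊩ D → Γ ⊩ D
  cases d a b = theorem ∨E · (ƛ a) · (ƛ b) · d

  v0 : A ∷ Γ ⊩ A
  v0 = hyp (here refl)

  v1 : B ∷ A ∷ Γ ⊩ A
  v1 = hyp (there (here refl))

  v2 : D ∷ B ∷ A ∷ Γ ⊩ A
  v2 = hyp (there (there (here refl)))

  ⇒-trans : T ⊢ (A ⇒ B) → T ⊢ (B ⇒ D) → T ⊢ (A ⇒ D)
  ⇒-trans f g = closed (ƛ theorem g · (theorem f · v0))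

  curry : T ⊢ (A ∧' B ⇒ D) → T ⊢ (A ⇒ B ⇒ D)
  curry f = closed (ƛ ƛ theorem f · pair v1 v0)

  ∀-elim-wk : ∀ A → T ⊢ (wk (∀' A) ⇒ A)
  ∀-elim-wk A = subst (λ X → T ⊢ (wk (∀' A) ⇒ X)) (lift-wk-[var0] A) (∀E (var 0))

  ∃-intro-wk : ∀ A → T ⊢ (A ⇒ wk (∃' A))
  ∃-intro-wk A = subst (λ X → T ⊢ (X ⇒ wk (∃' A))) (lift-wk-[var0] A) (∃I (var 0))

  ∀-map : T ⊢ (A ⇒ B) → T ⊢ (∀' A ⇒ ∀' B)
  ∀-map {A} f = ∀I (⇒-trans (∀-elim-wk A) f)

  ∃-map : T ⊢ (A ⇒ B) → T ⊢ (∃' A ⇒ ∃' B)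
  ∃-map {B = B} f = ∃E (⇒-trans f (∃-intro-wk B))

-- The slash translation

tr : Formula → Formula → Formula
tr χ (t ≐ s)  = t ≐ s ∨' ¬' χ
tr χ ⊥'       = ¬' χ
tr χ (A ∧' B) = tr χ A ∧' tr χ B
tr χ (A ∨' B) = tr χ A ∨' tr χ B
tr χ (A ⇒ B)  = (tr χ A ⇒ tr χ B) ∧' (χ ⇒ A ⇒ B)
tr χ (∀' A)   = ∀' (tr (wk χ) A)
tr χ (∃' A)   = ∃' (tr (wk χ) A)

substF-tr : ∀ σ χ A → substF σ (tr χ A) ≡ tr (substF σ χ) (substF σ A)
substF-tr σ χ (t ≐ s)  = refl
substF-tr σ χ ⊥'       = refl
substF-tr σ χ (A ∧' B) = cong₂ _∧'_ (substF-tr σ χ A) (substF-tr σ χ B)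
substF-tr σ χ (A ∨' B) = cong₂ _∨'_ (substF-tr σ χ A) (substF-tr σ χ B)
substF-tr σ χ (A ⇒ B)  = cong (_∧' substF σ (χ ⇒ A ⇒ B)) (cong₂ _⇒_ (substF-tr σ χ A) (substF-tr σ χ B))
substF-tr σ χ (∀' A)   = cong ∀' (trans (substF-tr (lift σ) (wk χ) A)
                                        (cong (λ X → tr X (substF (lift σ) A)) (substF-lift-wk σ χ)))
substF-tr σ χ (∃' A)   = cong ∃' (trans (substF-tr (lift σ) (wk χ) A)
                                        (cong (λ X → tr X (substF (lift σ) A)) (substF-lift-wk σ χ)))

-- The instantiated variable does not occur in `wk χ`, so the parameter comes back as `χ`.
tr-[] : ∀ χ A t → tr (wk χ) A [ t ] ≡ tr χ (A [ t ])
tr-[] χ A t = trans (substF-tr (sub0 t) (wk χ) A) (cong (λ X → tr X (A [ t ])) (wk-[] χ t))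

tr-subSuc : ∀ χ A → substF subSuc (tr (wk χ) A) ≡ tr (wk χ) (substF subSuc A)
tr-subSuc χ A = trans (substF-tr subSuc (wk χ) A)
                      (cong (λ X → tr X (substF subSuc A)) (subSuc-wk χ))

-- Soundness of the translation for intuitionistic logic

module Translation (T : Formula → Set) where

  open Entailment T

  -- Since ⊥ translates to ¬χ, this is the translated ex falso.
  tr-explode : ∀ χ A → T ⊢ (¬' χ ⇒ tr χ A)
  tr-explode χ (t ≐ s)  = ∨I₂
  tr-explode χ ⊥'       = closed (ƛ v0)
  tr-explode χ (A ∧' B) = closed (ƛ pair (theorem (tr-explode χ A) · v0) (theorem (tr-explode χ B) · v0))
  tr-explode χ (A ∨' B) = closed (ƛ inl (theorem (tr-explode χ A) · v0))
  tr-explode χ (A ⇒ B)  = closed (ƛ pair (ƛ theorem (tr-explode χ B) · v1)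
                                         (ƛ theorem efq · (v1 · v0)))
  tr-explode χ (∀' A)   = ∀I (tr-explode (wk χ) A)
  -- Any witness would do; zero is a term that is always available.
  tr-explode χ (∃' A)   = ⇒-trans (∀I (tr-explode (wk χ) A)) (⇒-trans (∀E zeroT) (∃I zeroT))

  -- Given χ, the added disjuncts ¬χ are absurd. Induction alone would fail at an implication, whose
  -- premise is contravariant; the second conjunct in `tr` is there for this case.
  tr-mono : ∀ χ A → T ⊢ (tr χ A ⇒ χ ⇒ A)
  tr-mono χ (t ≐ s)  = closed (ƛ ƛ cases v1 v0 (theorem efq · (v0 · v1)))
  tr-mono χ ⊥'       = closed (ƛ v0)
  tr-mono χ (A ∧' B) = closed (ƛ ƛ pair (theorem (tr-mono χ A) · fst v1 · v0)
                                        (theorem (tr-mono χ B) · snd v1 · v0))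
  tr-mono χ (A ∨' B) = closed (ƛ ƛ cases v1 (inl (theorem (tr-mono χ A) · v0 · v1))
                                            (inr (theorem (tr-mono χ B) · v0 · v1)))
  tr-mono χ (A ⇒ B)  = ∧E₂
  -- `∀I` takes a single premise, so the translated universal and χ are packed into one conjunction.
  tr-mono χ (∀' A)   = curry (∀I (closed (ƛ theorem (tr-mono (wk χ) A)
                         · (theorem (∀-elim-wk (tr (wk χ) A)) · fst v0) · snd v0)))
  tr-mono χ (∃' A)   = ∃E (closed (ƛ ƛ theorem (∃-intro-wk A)
                         · (theorem (tr-mono (wk χ) A) · v1 · v0)))

  -- The guarded conjunct needs the untranslated derivation `d` as well: under χ, `tr-mono` recovers
  -- its context from the translated one.
  tr-ƛ : ∀ χ Γ A B → A ∷ Γ ⊩ B → tr χ A ∷ List.map (tr χ) Γ ⊩ tr χ B →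
         List.map (tr χ) Γ ⊩ tr χ (A ⇒ B)
  tr-ƛ χ Γ A B d d* = pair (ƛ d*) (ƛ theorem (derivation (ƛ d)) · context Γ (λ A∈ → A∈))
    where
    context : ∀ Δ → (∀ {X} → X ∈ List.map (tr χ) Δ → X ∈ List.map (tr χ) Γ) →
              χ ∷ List.map (tr χ) Γ ⊩ ⋀ Δ
    context []      _   = theorem efq
    context (X ∷ Δ) Δ⊆Γ = pair (theorem (tr-mono χ X) · hyp (there (Δ⊆Γ (here refl))) · v0)
                               (context Δ (Δ⊆Γ ∘ there))

  tr-⇒₁ : ∀ χ A B → T ⊢ (A ⇒ B) → tr χ A ∷ [] ⊩ tr χ B → T ⊢ tr χ (A ⇒ B)
  tr-⇒₁ χ A B d d* = closed (tr-ƛ χ [] A B (unƛ (theorem d)) d*)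

  tr-⇒₂ : ∀ χ A B D → T ⊢ (A ⇒ B ⇒ D) → tr χ B ∷ tr χ A ∷ [] ⊩ tr χ D →
          T ⊢ tr χ (A ⇒ B ⇒ D)
  tr-⇒₂ χ A B D d d* =
    tr-⇒₁ χ A (B ⇒ D) d (tr-ƛ χ (A ∷ []) B D (unƛ (unƛ (theorem d))) d*)

  tr-⇒₃ : ∀ χ A B D E → T ⊢ (A ⇒ B ⇒ D ⇒ E) →
          tr χ D ∷ tr χ B ∷ tr χ A ∷ [] ⊩ tr χ E → T ⊢ tr χ (A ⇒ B ⇒ D ⇒ E)
  tr-⇒₃ χ A B D E d d* =
    tr-⇒₂ χ A B (D ⇒ E) d (tr-ƛ χ (B ∷ A ∷ []) D E (unƛ (unƛ (unƛ (theorem d)))) d*)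

  -- By induction on derivations, for all χ at once because the quantifier rules call the hypothesis
  -- at `wk χ`. Each logical axiom itself serves as the untranslated half.
  tr-sound : (∀ χ {A} → T A → T ⊢ tr χ A) → ∀ χ {A} → T ⊢ A → T ⊢ tr χ A
  tr-sound ax χ (axiom a) = ax χ a
  tr-sound ax χ (K {A} {B}) = tr-⇒₂ χ A B A K v1
  tr-sound ax χ (Sc {A} {B} {D}) =
    tr-⇒₃ χ (A ⇒ B ⇒ D) (A ⇒ B) A D Sc (fst (fst v2 · v0) · (fst v1 · v0))
  tr-sound ax χ (∧E₁ {A} {B}) = tr-⇒₁ χ (A ∧' B) A ∧E₁ (fst v0)
  tr-sound ax χ (∧E₂ {A} {B}) = tr-⇒₁ χ (A ∧' B) B ∧E₂ (snd v0)
  tr-sound ax χ (∧I {A} {B}) = tr-⇒₂ χ A B (A ∧' B) ∧I (pair v1 v0)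
  tr-sound ax χ (∨I₁ {A} {B}) = tr-⇒₁ χ A (A ∨' B) ∨I₁ (inl v0)
  tr-sound ax χ (∨I₂ {A} {B}) = tr-⇒₁ χ B (A ∨' B) ∨I₂ (inr v0)
  tr-sound ax χ (∨E {A} {B} {D}) =
    tr-⇒₃ χ (A ⇒ D) (B ⇒ D) (A ∨' B) D ∨E
      (cases v0 (weaken there (fst v2) · v0) (weaken there (fst v1) · v0))
  tr-sound ax χ (efq {A}) = tr-⇒₁ χ ⊥' A efq (theorem (tr-explode χ A) · v0)
  tr-sound ax χ (∀E {A} t) = tr-⇒₁ χ (∀' A) (A [ t ]) (∀E t)
    (subst (∀' (tr (wk χ) A) ∷ [] ⊩_) (tr-[] χ A t) (theorem (∀E t) · v0))
  tr-sound ax χ (∃I {A} t) = tr-⇒₁ χ (A [ t ]) (∃' A) (∃I t)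
    (subst (λ X → X ∷ [] ⊩ ∃' (tr (wk χ) A)) (tr-[] χ A t) (theorem (∃I t) · v0))
  tr-sound ax χ (mp {A} {B} d e) = mp (mp ∧E₁ (tr-sound ax χ d)) (tr-sound ax χ e)
  tr-sound ax χ (∀I {A} {B} d) = tr-⇒₁ χ B (∀' A) (∀I d) (unƛ (theorem (∀I
    (subst (λ X → T ⊢ (X ⇒ tr (wk χ) A)) (sym (substF-tr (var ∘ suc) χ B))
           (mp ∧E₁ (tr-sound ax (wk χ) d))))))
  tr-sound ax χ (∃E {A} {B} d) = tr-⇒₁ χ (∃' A) B (∃E d) (unƛ (theorem (∃E
    (subst (λ X → T ⊢ (tr (wk χ) A ⇒ X)) (sym (substF-tr (var ∘ suc) χ B))
           (mp ∧E₁ (tr-sound ax (wk χ) d))))))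

-- Translating the axioms of arithmetic and LEM for Σ_k

module SemiClassical (k : ℕ) where

  open Entailment (Ax k)
  open Translation (Ax k)

  mutual
    QF⇒Σ : ∀ m {A} → QF A → Σ-form m A
    QF⇒Σ zero    q = σ0 q
    QF⇒Σ (suc m) q = σS 0 (QF⇒Π m q)

    QF⇒Π : ∀ m {A} → QF A → Π-form m A
    QF⇒Π zero    q = π0 q
    QF⇒Π (suc m) q = πS 0 (QF⇒Σ m q)

  -- Empty quantifier blocks place every quantifier-free formula in Σ_k, so the LEM scheme covers
  -- it.
  QF-dec : ∀ {A} → QF A → Ax k ⊢ (A ∨' ¬' A)
  QF-dec q = axiom (lem (QF⇒Σ k q))

  mutual
    QF⇒tr : ∀ χ {A} → QF A → Ax k ⊢ (A ⇒ tr χ A)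
    QF⇒tr χ qf≐ = ∨I₁
    QF⇒tr χ qf⊥ = efq
    QF⇒tr χ (qf∧ p q) = closed (ƛ pair (theorem (QF⇒tr χ p) · fst v0) (theorem (QF⇒tr χ q) · snd v0))
    QF⇒tr χ (qf∨ p q) = closed (ƛ cases v0 (inl (theorem (QF⇒tr χ p) · v0)) (inr (theorem (QF⇒tr χ q) · v0)))
    QF⇒tr χ (qf⇒ {A} {B} p q) = closed (ƛ pair
      (ƛ cases (theorem (tr⇒QF χ p) · v0)
               (theorem (QF⇒tr χ q) · (v2 · v0))
               (theorem (tr-explode χ B) · v0))
      (ƛ v1))

    -- With `QF⇒tr` and `tr-explode`, this makes the translation of a quantifier-free A equivalent
    -- to A ∨ ¬χ. The two inductions are mutual because implication reverses its premise.
    tr⇒QF : ∀ χ {A} → QF A → Ax k ⊢ (tr χ A ⇒ A ∨' ¬' χ)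
    tr⇒QF χ qf≐ = closed (ƛ v0)
    tr⇒QF χ qf⊥ = ∨I₂
    tr⇒QF χ (qf∧ p q) = closed (ƛ
      cases (theorem (tr⇒QF χ p) · fst v0)
            (cases (theorem (tr⇒QF χ q) · snd v1) (inl (pair v1 v0)) (inr v0))
            (inr v0))
    tr⇒QF χ (qf∨ p q) = closed (ƛ
      cases v0 (cases (theorem (tr⇒QF χ p) · v0) (inl (inl v0)) (inr v0))
               (cases (theorem (tr⇒QF χ q) · v0) (inl (inr v0)) (inr v0)))
    tr⇒QF χ (qf⇒ p q) = closed (ƛ
      -- Only a decided premise lets the disjunction with ¬χ be pulled out of the implication.
      cases (theorem (QF-dec p))
            (cases (theorem (tr⇒QF χ q) · (fst v1 · (theorem (QF⇒tr χ p) · v0)))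
                   (inl (ƛ v1))
                   (inr v0))
            (inl (ƛ theorem efq · (v1 · v0))))

  exs⇒tr : ∀ n {A} → (∀ χ → Ax k ⊢ (A ⇒ tr χ A)) → ∀ χ → Ax k ⊢ (exs n A ⇒ tr χ (exs n A))
  exs⇒tr zero    f χ = f χ
  exs⇒tr (suc n) f χ = ∃-map (exs⇒tr n f (wk χ))

  alls⇒tr : ∀ n {A} → (∀ χ → Ax k ⊢ (A ⇒ tr χ A)) → ∀ χ → Ax k ⊢ (alls n A ⇒ tr χ (alls n A))
  alls⇒tr zero    f χ = f χ
  alls⇒tr (suc n) f χ = ∀-map (alls⇒tr n f (wk χ))

  mutual
    -- Quantifiers translate to themselves and are monotone, so the claim rises from the
    -- quantifier-free matrix through every block.
    Σ⇒tr : ∀ {m A} → Σ-form m A → ∀ χ → Ax k ⊢ (A ⇒ tr χ A)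
    Σ⇒tr (σ0 q)   χ = QF⇒tr χ q
    Σ⇒tr (σS n p)   = exs⇒tr n (Π⇒tr p)

    Π⇒tr : ∀ {m A} → Π-form m A → ∀ χ → Ax k ⊢ (A ⇒ tr χ A)
    Π⇒tr (π0 q)   χ = QF⇒tr χ q
    Π⇒tr (πS n s)   = alls⇒tr n (Σ⇒tr s)

  tr-HA-Ax : ∀ χ {A} → HA-Ax A → Ax k ⊢ tr χ A
  tr-HA-Ax χ (eq-refl t) = mp ∨I₁ (axiom (ha (eq-refl t)))
  tr-HA-Ax χ (eq-subst t s A) =
    tr-⇒₂ χ (t ≐ s) (A [ t ]) (A [ s ]) (axiom (ha (eq-subst t s A)))
      (cases v1
        -- The same scheme, taken at the translated formula.
        (theorem (subst₂ (λ X Y → Ax k ⊢ (t ≐ s ⇒ X ⇒ Y)) (tr-[] χ A t) (tr-[] χ A s)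
                         (axiom (ha (eq-subst t s (tr (wk χ) A)))))
          · v0 · v1)
        (theorem (tr-explode χ (A [ s ])) · v0))
  tr-HA-Ax χ (suc-ne0 t) =
    tr-⇒₁ χ (sucT t ≐ zeroT) ⊥' (axiom (ha (suc-ne0 t)))
      (cases v0 (theorem efq · (theorem (axiom (ha (suc-ne0 t))) · v0)) v0)
  tr-HA-Ax χ (suc-inj t s) =
    tr-⇒₁ χ (sucT t ≐ sucT s) (t ≐ s) (axiom (ha (suc-inj t s)))
      (cases v0 (inl (theorem (axiom (ha (suc-inj t s))) · v0)) (inr v0))
  tr-HA-Ax χ (ax-P i ts)      = mp ∨I₁ (axiom (ha (ax-P i ts)))
  tr-HA-Ax χ (ax-C f gs ts)   = mp ∨I₁ (axiom (ha (ax-C f gs ts)))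
  tr-HA-Ax χ (ax-R0 f g ts)   = mp ∨I₁ (axiom (ha (ax-R0 f g ts)))
  tr-HA-Ax χ (ax-RS f g t ts) = mp ∨I₁ (axiom (ha (ax-RS f g t ts)))
  tr-HA-Ax χ (ind A) =
    tr-⇒₂ χ (A [ zeroT ]) (∀' (A ⇒ substF subSuc A)) (∀' A) (axiom (ha (ind A)))
      -- Induction on the translated formula; its step is the first conjunct of the translated step.
      (theorem (subst₂ (λ X Y → Ax k ⊢ (X ⇒ ∀' (tr (wk χ) A ⇒ Y) ⇒ ∀' (tr (wk χ) A)))
                       (tr-[] χ A zeroT) (tr-subSuc χ A)
                       (axiom (ha (ind (tr (wk χ) A)))))
        · v1 · (theorem (∀-map ∧E₁) · v0))

  tr-Ax : ∀ χ {A} → Ax k A → Ax k ⊢ tr χ A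
  tr-Ax χ (ha a) = tr-HA-Ax χ a
  tr-Ax χ (lem {A} s) = closed
    (cases (theorem (axiom (lem s)))
      (inl (theorem (Σ⇒tr s χ) · v0))
      -- The translation of ⊥ is ¬χ, so χ joins the hypotheses and `tr-mono` yields A against ¬A.
      (inr (pair (ƛ ƛ v2 · (theorem (tr-mono χ A) · v1 · v0)) (ƛ v1))))

theorem8p4 : (k : ℕ) (φ ψ : Formula) →
    HA+LEM k (¬' φ ⇒ ∃' ψ) → HA+LEM k (∃' (¬' (wk φ) ⇒ ψ))
-- The translated existential is not guarded by χ, so its witness comes before the premise;
-- `tr-mono` then restores ¬φ in front of ψ under the quantifier.
theorem8p4 k φ ψ d = mp (∃-map (tr-mono (¬' (wk φ)) ψ)) (mp (mp ∧E₁ (tr-sound tr-Ax (¬' φ) d)) ¬φ*)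
  where
  open Entailment (Ax k)
  open Translation (Ax k)
  open SemiClassical k
  ¬φ* : Ax k ⊢ tr (¬' φ) (¬' φ)
  -- As χ is ¬φ itself, the guarded conjunct is the identity.
  ¬φ* = closed (pair (ƛ ƛ v0 · (theorem (tr-mono (¬' φ) φ) · v1 · v0)) (ƛ v0))
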